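{- $\mathsf{TC}^{\mathsf c}_{1,\lambda}$ proves: if $x*y=u*v$ and $\Lambda(x)=\Lambda(u)$, then $x=u$ and $y=v$.
   Context: $\mathsf{TC}_1$ is the theory in the language with a constant $\varnothing$ and binary function $*$, axiomatised by: $\varnothing*x=x\wedge x*\varnothing=x$; $x*y=\varnothing\to(x=\varnothing\wedge y=\varnothing)$; $(x*y)*z=x*(y*z)$; and $x*y=u*v\to\exists w\,((x*w=u\wedge y=w*v)\vee(x=u*w\wedge w*y=v))$. An atom is an $a\neq\varnothing$ such that for all $x,y$, if $x*y=a$ then $x=\varnothing$ or $y=\varnothing$; $x\preceq y$ means $\exists u\,\exists v\,y=(u*x)*v$. $\mathsf{TC}^{\mathsf c}_{1,\lambda}$ is $\mathsf{TC}_1$ extended with a constant $\mathtt b$ (axiom: $\mathtt b$ is an atom), Left Cancellation $x*y=x*z\to y=z$, and a unary function $\Lambda$ with axioms $\Lambda(\varnothing)=\varnothing$; $\Lambda(x)=\varnothing\to x=\varnothing$; $\Lambda(x*y)=\Lambda(x)*\Lambda(y)$; $\Lambda(\Lambda(x))=\Lambda(x)$; $\mathtt b\not\preceq\Lambda(x)$. -}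

module Defs where

open import Level using (Level; suc; _⊔_)
open import Data.Product using (Σ; ∃; _×_; _,_)
open import Data.Sum using (_⊎_)
open import Relation.Nullary using (¬_)
open import Relation.Binary.PropositionalEquality using (_≡_; _≢_)

record TC1 (ℓ : Level) : Set (suc ℓ) where
  infixl 7 _*_
  field
    Carrier : Set ℓ
    ∅       : Carrier
    _*_     : Carrier → Carrier → Carrier
    ax-unitˡ  : ∀ x → ∅ * x ≡ x
    ax-unitʳ  : ∀ x → x * ∅ ≡ x
    ax-noinv  : ∀ x y → x * y ≡ ∅ → (x ≡ ∅ × y ≡ ∅)
    ax-assoc  : ∀ x y z → (x * y) * z ≡ x * (y * z)
    ax-edit   : ∀ x y u v → x * y ≡ u * v →
                Σ Carrier λ w → ((x * w ≡ u) × (y ≡ w * v)) ⊎ ((x ≡ u * w) × (w * y ≡ v))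

  IsAtom : Carrier → Set ℓ
  IsAtom a = (a ≢ ∅) × (∀ x y → x * y ≡ a → (x ≡ ∅) ⊎ (y ≡ ∅))

  infix 4 _⪯_
  _⪯_ : Carrier → Carrier → Set ℓ
  x ⪯ y = Σ Carrier λ u → Σ Carrier λ v → y ≡ (u * x) * v

record TC1cλ (ℓ : Level) : Set (suc ℓ) where
  field
    tc1 : TC1 ℓ
  open TC1 tc1 public
  field
    b        : Carrier
    ax-b     : IsAtom b
    ax-lcanc : ∀ x y z → x * y ≡ x * z → y ≡ z
    Λ        : Carrier → Carrier
    ax-Λ∅    : Λ ∅ ≡ ∅
    ax-Λ0    : ∀ x → Λ x ≡ ∅ → x ≡ ∅
    ax-Λ*    : ∀ x y → Λ (x * y) ≡ Λ x * Λ y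
    ax-ΛΛ    : ∀ x → Λ (Λ x) ≡ Λ x
    ax-bΛ    : ∀ x → ¬ (b ⪯ Λ x)

{-# OPTIONS --safe #-}
-- By the editing axiom, x * y = u * v means that one of x, u extends the other
-- by some w. Since Λ is a homomorphism, Λ x = Λ u then gives Λ x * Λ w = Λ x * ∅
-- for the shorter prefix, so left cancellation forces Λ w = ∅, hence w = ∅.
module Submission where

open import Defs
open import Level using (Level)
open import Data.Product using (_×_; _,_; map)
open import Data.Sum using (inj₁; inj₂)
open import Relation.Binary.PropositionalEquality
  using (_≡_; sym; cong; module ≡-Reasoning)

module Properties {ℓ : Level} (M : TC1cλ ℓ) where
  open TC1cλ M
  open ≡-Reasoning

  *-identityʳ-unique : ∀ x w → x * w ≡ x → w ≡ ∅
  *-identityʳ-unique x w xw≡x = sym (ax-lcanc x ∅ w (begin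
    x * ∅  ≡⟨ ax-unitʳ x ⟩
    x      ≡⟨ sym xw≡x ⟩
    x * w  ∎))

  Λ-extension-trivial : ∀ x w → Λ (x * w) ≡ Λ x → w ≡ ∅
  Λ-extension-trivial x w Λxw≡Λx = ax-Λ0 w (*-identityʳ-unique (Λ x) (Λ w) (begin
    Λ x * Λ w  ≡⟨ sym (ax-Λ* x w) ⟩
    Λ (x * w)  ≡⟨ Λxw≡Λx ⟩
    Λ x        ∎))

  split-unique : ∀ x y u v w → x * w ≡ u → y ≡ w * v → Λ x ≡ Λ u →
                 (x ≡ u) × (y ≡ v)
  split-unique x y u v w xw≡u y≡wv Λx≡Λu = x≡u , y≡v
    where
    w≡∅ : w ≡ ∅
    w≡∅ = Λ-extension-trivial x w (begin
      Λ (x * w)  ≡⟨ cong Λ xw≡u ⟩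
      Λ u        ≡⟨ sym Λx≡Λu ⟩
      Λ x        ∎)

    x≡u : x ≡ u
    x≡u = begin
      x      ≡⟨ sym (ax-unitʳ x) ⟩
      x * ∅  ≡⟨ cong (x *_) (sym w≡∅) ⟩
      x * w  ≡⟨ xw≡u ⟩
      u      ∎

    y≡v : y ≡ v
    y≡v = begin
      y      ≡⟨ y≡wv ⟩
      w * v  ≡⟨ cong (_* v) w≡∅ ⟩
      ∅ * v  ≡⟨ ax-unitˡ v ⟩
      v      ∎

mainTheorem19 : ∀ {ℓ : Level} (M : TC1cλ ℓ) → let open TC1cλ M in
    ∀ x y u v → x * y ≡ u * v → Λ x ≡ Λ u → (x ≡ u) × (y ≡ v)
mainTheorem19 M x y u v xy≡uv Λx≡Λu with TC1cλ.ax-edit M x y u v xy≡uv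
... | w , inj₁ (xw≡u , y≡wv) = split-unique x y u v w xw≡u y≡wv Λx≡Λu
  where open Properties M
... | w , inj₂ (x≡uw , wy≡v) =
  map sym sym (split-unique u v x y w (sym x≡uw) (sym wy≡v) (sym Λx≡Λu))
  where open Properties M
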